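{- A (possibly infinite) tree $T$ is cat-win if and only if $T$ contains the infinite complete binary tree $B^{\omega}$ as a minor.
   Context: Cat Herding is played on a simple, possibly infinite graph $G$. The cat first places its token on a vertex. Then the players alternate, the herder moving first: the herder deletes one edge of the current graph, and then, unless the cat's current vertex has degree $0$ in the current graph, the cat moves its token along a finite path with at least one edge in the current graph to a different vertex. The cat is captured when its vertex has degree $0$ in the current graph. $G$ is cat-win if the cat has a strategy (including the choice of starting vertex) that is never captured, and herder-win if the herder has a strategy that eventually captures the cat. $B^{\omega}$ is the graph with vertex set $\{L,R\}^*$ (all finite words over $\{L,R\}$) and edges between $\alpha$ and $\alpha t$ for all $\alpha\in\{L,R\}^*$, $t\in\{L,R\}$. -}

module Defs where

open import Level using (Level; _⊔_; 0ℓ) renaming (suc to lsuc)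
open import Data.Empty using (⊥)
open import Data.List using (List; []; _∷_; _∷ʳ_; length)
open import Data.List.Relation.Unary.All using (All)
open import Data.List.Relation.Unary.Unique.Propositional using (Unique)
open import Data.Nat using (_≤_)
open import Data.Product using (Σ-syntax; ∃; ∃-syntax; _×_; _,_; swap)
open import Data.Sum using (_⊎_; inj₁; inj₂)
import Data.Sum as Sum
open import Relation.Binary.Core using (Rel)
open import Relation.Binary.Definitions using (Symmetric; Irreflexive)
open import Relation.Binary.Construct.Closure.ReflexiveTransitive using (Star; ε; _◅_)
open import Relation.Binary.PropositionalEquality using (_≡_; _≢_; refl; sym; cong)
open import Relation.Nullary using (¬_)
open import Relation.Unary using (Pred)

private
  variable
    ℓ m : Level

-- Only the inhabitedness of E x y matters, so there are no multi-edges.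

record Graph (V : Set ℓ) : Set (lsuc ℓ) where
  field
    E        : Rel V ℓ
    E-sym    : Symmetric E
    E-irrefl : Irreflexive _≡_ E

open Graph public

module _ {V : Set ℓ} where

  Walk : Graph V → V → V → Set ℓ
  Walk G = Star (E G)

  vertices : {_∼_ : Rel V ℓ} {u v : V} → Star _∼_ u v → List V
  vertices {v = v} ε             = v ∷ []
  vertices (_◅_ {i = u} _ walk)  = u ∷ vertices walk

  Path : Graph V → V → V → Set ℓ
  Path G u v = Σ[ w ∈ Walk G u v ] Unique (vertices w)

  -- A cycle is a path on at least three vertices closed up by an edge
  -- between its ends.
  Cycle : Graph V → Set ℓ
  Cycle G = ∃[ u ] ∃[ v ] Σ[ (w , _) ∈ Path G u v ] (3 ≤ length (vertices w) × E G v u)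

  record IsTree (G : Graph V) : Set ℓ where
    field
      inhabited : V
      connected : ∀ u v → Path G u v
      acyclic   : ¬ Cycle G

  Isolated : Graph V → V → Set ℓ
  Isolated G v = ∀ w → ¬ E G v w

  infixl 6 _∖_ _∖∖_

  -- Both orientations of the pair are removed.
  _∖_ : Graph V → V × V → Graph V
  E        (G ∖ e) x y = E G x y × (x , y) ≢ e × (x , y) ≢ swap e
  E-sym    (G ∖ e) (xy , ≢e , ≢e′) =
    E-sym G xy , (λ eq → ≢e′ (cong swap eq)) , (λ eq → ≢e (cong swap eq))
  E-irrefl (G ∖ e) x≡y (xy , _) = E-irrefl G x≡y xy

  -- Lists of deleted edges have the most recent deletion at the head.
  _∖∖_ : Graph V → List (V × V) → Graph V
  G ∖∖ []       = G
  G ∖∖ (e ∷ es) = (G ∖∖ es) ∖ e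

  data Deletions (G : Graph V) : List (V × V) → Set ℓ where
    []  : Deletions G []
    _∷_ : ∀ {a b es} → E (G ∖∖ es) a b → Deletions G es → Deletions G ((a , b) ∷ es)

  -- As the ends of the path differ, it has at least one edge.
  CatMove : Graph V → V → V → Set ℓ
  CatMove G u v = u ≢ v × Path G u v

  -- Once the cat's strategy is fixed, a play is determined by the edges the
  -- herder has deleted so far, so a strategy is a function of that list:
  -- `token es` is where the cat stands after answering the last deletion in
  -- `es`, and `token []` is its starting vertex.  Capture is tested at the
  -- start and after each deletion, while the cat is still on `token es`; a
  -- legal move never ends at a vertex of degree 0.
  record CatWin (G : Graph V) : Set ℓ where
    field
      token           : List (V × V) → V
      legal           : ∀ e es → Deletions G (e ∷ es) →
                        ¬ Isolated (G ∖∖ (e ∷ es)) (token es) →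
                        CatMove (G ∖∖ (e ∷ es)) (token es) (token (e ∷ es))
      start-uncaught  : ¬ Isolated G (token [])
      uncaught        : ∀ e es → Deletions G (e ∷ es) →
                        ¬ Isolated (G ∖∖ (e ∷ es)) (token es)

  -- The subgraph of G induced on S is connected.
  ConnectedOn : Graph V → Pred V ℓ → Set ℓ
  ConnectedOn G S = ∀ {u v} → S u → S v → Σ[ (w , _) ∈ Path G u v ] All S (vertices w)

infix 4 _IsMinorOf_

record _IsMinorOf_ {W : Set m} {V : Set ℓ} (H : Graph W) (G : Graph V) : Set (m ⊔ lsuc ℓ) where
  field
    branch    : W → Pred V ℓ
    nonempty  : ∀ x → ∃ (branch x)
    connected : ∀ x → ConnectedOn G (branch x)
    disjoint  : ∀ {x y v} → branch x v → branch y v → x ≡ y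
    edges     : ∀ {x y} → E H x y → ∃[ u ] ∃[ v ] (branch x u × branch y v × E G u v)

data Letter : Set where
  L R : Letter

private
  ≢∷ʳ : (α : List Letter) {t : Letter} → α ≡ α ∷ʳ t → ⊥
  ≢∷ʳ (s ∷ α) eq = ≢∷ʳ α (tail-≡ eq)
    where
    tail-≡ : ∀ {a b : Letter} {xs ys : List Letter} → a ∷ xs ≡ b ∷ ys → xs ≡ ys
    tail-≡ refl = refl

Bω : Graph (List Letter)
E        Bω α β = (∃[ t ] β ≡ α ∷ʳ t) ⊎ (∃[ t ] α ≡ β ∷ʳ t)
E-sym    Bω = Sum.swap
E-irrefl Bω {α} refl (inj₁ (t , eq)) = ≢∷ʳ α eq
E-irrefl Bω {α} refl (inj₂ (t , eq)) = ≢∷ʳ α eq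

{-# OPTIONS --safe #-}
-- If Bω is a minor of T, the cat stays at the end p α, in the branch set of
-- α, of the edge towards α L.  Its routes from p α into the subtrees at α L
-- and at α R, together with these subtrees, are edge-disjoint, so one of the
-- two survives the next deletion.
--
-- Conversely, fix a winning cat strategy, root T, and call a vertex c doomed
-- if no play lets the herder confine the cat to the subtree below c.  The
-- root is not doomed.  If v is not doomed, then some w below v has
-- two children that are not doomed: otherwise the vertices below v that are
-- not doomed form a single branch, and the herder first cuts it below the
-- cat, then cuts its remaining edges from the top, which confines the cat to
-- one vertex of the branch and doomed subtrees below it, and then to one of
-- these subtrees.  Iterating the forks gives the minor.
module Submission where

open import Defs
open import Level using (Level; suc; Lift; lift; lower)
open import Axiom.ExcludedMiddle using (ExcludedMiddle)
open import Data.Empty using (⊥; ⊥-elim)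
open import Data.List using (List; []; _∷_; _∷ʳ_; _++_; length)
open import Data.List.Membership.Propositional using (_∈_)
open import Data.List.Properties using (∷ʳ-++; ++-cancelˡ; ++-identityʳ)
open import Data.List.Relation.Unary.All as All using (All; []; _∷_)
open import Data.List.Relation.Unary.All.Properties using (¬Any⇒All¬)
open import Data.List.Relation.Unary.AllPairs using ([]; _∷_)
open import Data.List.Relation.Unary.Any using (here; there)
open import Data.List.Relation.Unary.Unique.Propositional using (Unique)
open import Data.Nat using (_≤_; z≤n; s≤s)
open import Data.Product using (Σ; Σ-syntax; ∃; ∃-syntax; _×_; _,_; proj₁; proj₂; swap; -,_)
open import Data.Product.Properties using (,-injectiveˡ; ,-injectiveʳ)
open import Data.Sum using (_⊎_; inj₁; inj₂)
open import Function using (_∘_)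
open import Function.Bundles using (_⇔_; mk⇔)
open import Relation.Binary.Core using (Rel)
open import Relation.Binary.Definitions using (Symmetric)
open import Relation.Binary.Construct.Closure.ReflexiveTransitive as Star
  using (Star; ε; _◅_; _◅◅_; reverse)
open import Relation.Binary.PropositionalEquality
open import Relation.Nullary using (¬_; Dec; yes; no)
open import Relation.Nullary.Decidable using (map′; decidable-stable)
open import Relation.Unary using (Pred; _⊆_)

private
  variable
    ℓ : Level

-- Walks, paths and bridges.

module _ {V : Set ℓ} where

  -- Vertices may repeat, so that such walks concatenate and reverse freely; `simplify` makes them
  -- simple when a path is called for.
  WalkIn : Rel V ℓ → Pred V ℓ → V → V → Set ℓ
  WalkIn _∼_ S u v = Σ[ w ∈ Star _∼_ u v ] All S (vertices w)

  infixr 5 _++ʷ_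

  private
    variable
      G : Graph V
      _∼_ : Rel V ℓ
      S : Pred V ℓ
      u v x y z : V

  start : WalkIn _∼_ S u v → S u
  start (ε     , s ∷ _) = s
  start (_ ◅ _ , s ∷ _) = s

  end : WalkIn _∼_ S u v → S v
  end (ε     , s ∷ _)  = s
  end (_ ◅ w , _ ∷ ss) = end (w , ss)

  _++ʷ_ : WalkIn _∼_ S u v → WalkIn _∼_ S v z → WalkIn _∼_ S u z
  (ε     , _)      ++ʷ q = q
  (e ◅ w , s ∷ ss) ++ʷ q = let (w′ , ss′) = (w , ss) ++ʷ q in e ◅ w′ , s ∷ ss′

  reverseʷ : Symmetric _∼_ → WalkIn _∼_ S u v → WalkIn _∼_ S v u
  reverseʷ ∼-sym (ε , ss)         = ε , ss
  reverseʷ ∼-sym (e ◅ w , s ∷ ss) =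
    reverseʷ ∼-sym (w , ss) ++ʷ (∼-sym e ◅ ε , start (w , ss) ∷ s ∷ [])

  restrict : {_≈_ : Rel V ℓ} → (∀ {a b} → S a → S b → a ∼ b → a ≈ b) →
             WalkIn _∼_ S u v → Star _≈_ u v
  restrict f (ε , _)          = ε
  restrict f (e ◅ w , s ∷ ss) = f s (start (w , ss)) e ◅ restrict f (w , ss)

  SimpleIn : Rel V ℓ → Pred V ℓ → V → V → Set ℓ
  SimpleIn _∼_ S u v =
    Σ[ (w , _) ∈ (Σ[ w ∈ Star _∼_ u v ] Unique (vertices w)) ] All S (vertices w)

  suffix : (w : Star _∼_ u v) → Unique (vertices w) → All S (vertices w) → x ∈ vertices w →
           SimpleIn _∼_ S x v
  suffix ε       uq       ss       (here refl) = (ε , uq) , ss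
  suffix (e ◅ w) uq       ss       (here refl) = (e ◅ w , uq) , ss
  suffix (e ◅ w) (_ ∷ uq) (_ ∷ ss) (there m)   = suffix w uq ss m

  avoid₁ : ∀ G → WalkIn (E G) (_≢ x) u v → Walk (G ∖ (x , y)) u v
  avoid₁ _ = restrict λ a≢x b≢x e → e , (a≢x ∘ ,-injectiveˡ) , (b≢x ∘ ,-injectiveʳ)

  avoid₂ : ∀ G → WalkIn (E G) (_≢ y) u v → Walk (G ∖ (x , y)) u v
  avoid₂ _ = restrict λ a≢y b≢y e → e , (b≢y ∘ ,-injectiveʳ) , (a≢y ∘ ,-injectiveˡ)

  vertices-map : {_≈_ : Rel V ℓ} (f : ∀ {a b} → a ∼ b → a ≈ b) (w : Star _∼_ u v) →
                 vertices (Star.map {U = _≈_} f w) ≡ vertices w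
  vertices-map f ε       = refl
  vertices-map f (_ ◅ w) = cong (_ ∷_) (vertices-map f w)

  -- A one-edge walk would be the deleted edge, so a detour has the three vertices that `Cycle` asks
  -- for.
  detour-length : ∀ G → E G u v → (w : Walk (G ∖ (u , v)) u v) → 3 ≤ length (vertices w)
  detour-length G uv ε                   = ⊥-elim (E-irrefl G refl uv)
  detour-length G uv ((_ , ≢uv , _) ◅ ε) = ⊥-elim (≢uv refl)
  detour-length G uv (_ ◅ _ ◅ ε)         = s≤s (s≤s (s≤s z≤n))
  detour-length G uv (_ ◅ _ ◅ _ ◅ _)     = s≤s (s≤s (s≤s z≤n))

  not-isolated : ∀ G → u ≢ v → Walk G u v → ¬ Isolated G u
  not-isolated _ u≢v ε       _   = u≢v refl
  not-isolated _ _   (e ◅ _) iso = iso _ e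

  undelete : ∀ {G : Graph V} es → E (G ∖∖ es) x y → E G x y
  undelete []       e       = e
  undelete (_ ∷ es) (e , _) = undelete es e

  module _ (em : ExcludedMiddle ℓ) where

    -- Loop erasure: if `u` recurs on the simplified remainder, the suffix from that occurrence is
    -- already simple.
    simplify : WalkIn _∼_ S u v → SimpleIn _∼_ S u v
    simplify (ε , ss) = (ε , [] ∷ []) , ss
    simplify {u = u} (e ◅ w , s ∷ ss) with simplify (w , ss)
    ... | (w′ , uq) , ss′ with em {u ∈ vertices w′}
    ...   | yes m = suffix w′ uq ss′ m
    ...   | no ∉w = (e ◅ w′ , ¬Any⇒All¬ _ ∉w ∷ uq) , s ∷ ss′

    walk⇒path : ∀ G → Walk G u v → Path G u v
    walk⇒path _ w = proj₁ (simplify {S = λ x → x ≡ x} (w , All.universal (λ _ → refl) _))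

    -- A detour, made simple and closed up by the edge itself, is a cycle.
    bridge : ∀ G → ¬ Cycle G → E G u v → ¬ Walk (G ∖ (u , v)) u v
    bridge {u} {v} G acyclic uv w = acyclic
      (-, -, (Star.map proj₁ p , subst Unique (sym eq) uq) ,
       subst (λ xs → 3 ≤ length xs) (sym eq) (detour-length G uv p) , E-sym G uv)
      where
      path : Path (G ∖ (u , v)) u v
      path = walk⇒path (G ∖ (u , v)) w
      p  = proj₁ path
      uq = proj₂ path
      eq : vertices (Star.map {U = E G} proj₁ p) ≡ vertices p
      eq = vertices-map proj₁ p

-- From the minor to a strategy for the cat.

module MinorToCat (em : ExcludedMiddle ℓ) {V : Set ℓ} (T : Graph V) (M : Bω IsMinorOf T) where

  open _IsMinorOf_ M

  private
    Word : Set
    Word = List Letter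

  Cone : Word → Pred V ℓ
  Cone α v = ∃[ β ] branch (α ++ β) v

  -- The right route from `home α` has all its edges inside this set, while each edge of the left
  -- route has an end in `Cone (α ∷ʳ L)`, which is disjoint from it. So the cat turns left exactly
  -- when the deleted pair has both ends here.
  OffLeft : Word → Pred V ℓ
  OffLeft α v = branch α v ⊎ Cone (α ∷ʳ R) v

  module _ (α : Word) (t : Letter) where
    private
      edge = edges {α} {α ∷ʳ t} (inj₁ (t , refl))

    near far : V
    near = proj₁ edge
    far  = proj₁ (proj₂ edge)

    near∈ : branch α near
    near∈ = proj₁ (proj₂ (proj₂ edge))

    far∈ : branch (α ∷ʳ t) far
    far∈ = proj₁ (proj₂ (proj₂ (proj₂ edge)))

    near-far : E T near far
    near-far = proj₂ (proj₂ (proj₂ (proj₂ edge)))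

    Cone-∷ʳ : Cone (α ∷ʳ t) ⊆ Cone α
    Cone-∷ʳ (β , v∈) = t ∷ β , subst (λ γ → branch γ _) (∷ʳ-++ α t β) v∈

  home : Word → V
  home α = near α L

  branch⊆Cone : ∀ α → branch α ⊆ Cone α
  branch⊆Cone α v∈ = [] , subst (λ γ → branch γ _) (sym (++-identityʳ α)) v∈

  OffLeft⊆Cone : ∀ α → OffLeft α ⊆ Cone α
  OffLeft⊆Cone α (inj₁ v∈) = branch⊆Cone α v∈
  OffLeft⊆Cone α (inj₂ v∈) = Cone-∷ʳ α R v∈

  left-OffLeft-disjoint : ∀ α {v} → Cone (α ∷ʳ L) v → ¬ OffLeft α v
  left-OffLeft-disjoint α (β , v∈) (inj₁ v∈′)
    with ++-cancelˡ α (L ∷ β) []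
           (trans (sym (∷ʳ-++ α L β)) (trans (disjoint v∈ v∈′) (sym (++-identityʳ α))))
  ... | ()
  left-OffLeft-disjoint α (β , v∈) (inj₂ (γ , v∈′))
    with ++-cancelˡ α (L ∷ β) (R ∷ γ)
           (trans (sym (∷ʳ-++ α L β)) (trans (disjoint v∈ v∈′) (∷ʳ-++ α R γ)))
  ... | ()

  Intact : Pred V ℓ → List (V × V) → Set ℓ
  Intact S es = ∀ {a b} → S a → S b → E T a b → E (T ∖∖ es) a b

  within : ∀ {S} es α → branch α ⊆ S → Intact S es →
           ∀ {u v} → branch α u → branch α v → Walk (T ∖∖ es) u v
  within es α ⊆S intact u∈ v∈ =
    let (w , _) , ss = connected α u∈ v∈ in restrict intact (w , All.map ⊆S ss)

  -- Named so that `step` and `word` branch on the same decision.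
  hits? : ∀ α (e : V × V) → Dec (OffLeft α (proj₁ e) × OffLeft α (proj₂ e))
  hits? α e = em

  turn : {P : Set ℓ} → Dec P → Letter
  turn (yes _) = L
  turn (no _)  = R

  step : ∀ es α e → Intact (Cone α) es →
         let β = α ∷ʳ turn (hits? α e) in
         Walk (T ∖∖ (e ∷ es)) (home α) (home β) × Intact (Cone β) (e ∷ es)
  step es α e intact with hits? α e
  ... | yes (a∈ , b∈) =
    -- `home α` is itself an end of the left edge, so this route crosses at once and uses no edge
    -- inside `branch α`.
    (edge ◅ within (e ∷ es) (α ∷ʳ L) (branch⊆Cone (α ∷ʳ L)) left-intact (far∈ α L) (near∈ (α ∷ʳ L) L)) ,
    left-intact
    where
    safe : ∀ {x y} → Cone (α ∷ʳ L) y → (x , y) ≢ e × (x , y) ≢ swap e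
    safe y∈ = (λ { refl → left-OffLeft-disjoint α y∈ b∈ }) ,
              (λ { refl → left-OffLeft-disjoint α y∈ a∈ })
    left-intact : Intact (Cone (α ∷ʳ L)) (e ∷ es)
    left-intact x∈ y∈ xy = intact (Cone-∷ʳ α L x∈) (Cone-∷ʳ α L y∈) xy , safe y∈
    far∈Cone : Cone (α ∷ʳ L) (far α L)
    far∈Cone = branch⊆Cone (α ∷ʳ L) (far∈ α L)
    edge : E (T ∖∖ (e ∷ es)) (home α) (far α L)
    edge = intact (branch⊆Cone α (near∈ α L)) (Cone-∷ʳ α L far∈Cone) (near-far α L) ,
           safe far∈Cone
  ... | no missed =
    (within (e ∷ es) α inj₁ off-intact (near∈ α L) (near∈ α R) ◅◅
     off-intact (inj₁ (near∈ α R)) (inj₂ (branch⊆Cone (α ∷ʳ R) (far∈ α R))) (near-far α R) ◅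
     within (e ∷ es) (α ∷ʳ R) (inj₂ ∘ branch⊆Cone (α ∷ʳ R)) off-intact (far∈ α R) (near∈ (α ∷ʳ R) L)) ,
    λ x∈ y∈ → off-intact (inj₂ x∈) (inj₂ y∈)
    where
    off-intact : Intact (OffLeft α) (e ∷ es)
    off-intact x∈ y∈ xy = intact (OffLeft⊆Cone α x∈) (OffLeft⊆Cone α y∈) xy ,
      (λ { refl → missed (x∈ , y∈) }) , (λ { refl → missed (y∈ , x∈) })

  word : List (V × V) → Word
  word []       = []
  word (e ∷ es) = word es ∷ʳ turn (hits? (word es) e)

  word-intact : ∀ es → Intact (Cone (word es)) es
  word-intact []       _ _ xy = xy
  word-intact (e ∷ es) = proj₂ (step es (word es) e (word-intact es))

  home≢home-∷ʳ : ∀ α t → home α ≢ home (α ∷ʳ t)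
  home≢home-∷ʳ α t eq = E-irrefl Bω refl
    (inj₁ (t , disjoint (near∈ α L) (subst (branch (α ∷ʳ t)) (sym eq) (near∈ (α ∷ʳ t) L))))

  catWin : CatWin T
  catWin = record
    { token          = home ∘ word
    ; legal          = λ e es _ _ → home≢home-∷ʳ (word es) _ , walk⇒path em (T ∖∖ (e ∷ es)) (move e es)
    ; start-uncaught = λ iso → iso _ (near-far [] L)
    ; uncaught       = λ e es _ → not-isolated (T ∖∖ (e ∷ es)) (home≢home-∷ʳ (word es) _) (move e es)
    }
    where
    move : ∀ e es → Walk (T ∖∖ (e ∷ es)) (home (word es)) (home (word (e ∷ es)))
    move e es = proj₁ (step es (word es) e (word-intact es))

-- The tree order below a root.

module Rooted (em : ExcludedMiddle ℓ) {V : Set ℓ} (T : Graph V) (tree : IsTree T) where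

  open IsTree tree renaming (inhabited to root)

  private
    variable
      a b c d w x y z : V

  -- Orients edges without distances: the parent is the end that the root reaches while avoiding the
  -- other.
  Child : V → V → Set ℓ
  Child x y = E T x y × WalkIn (E T) (_≢ y) root x

  infix 4 _↓_

  _↓_ : V → V → Set ℓ
  _↓_ = Star Child

  -- Whichever end a walk from the root meets first is the parent, since up to there the walk misses
  -- the other.
  orient : E T x y → Child x y ⊎ Child y x
  orient {x} {y} xy = first-hit (proj₁ (connected root x))
    where
    x≢y : x ≢ y
    x≢y eq = E-irrefl T eq xy

    Hit : V → Set ℓ
    Hit s = (E T x y × WalkIn (E T) (_≢ y) s x) ⊎ (E T y x × WalkIn (E T) (_≢ x) s y)

    first-hit : ∀ {s} → Walk T s x → Hit s
    first-hit ε = inj₁ (xy , ε , x≢y ∷ [])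
    first-hit {s} (e ◅ w) with em {s ≡ x} | em {s ≡ y}
    ... | yes refl | _        = inj₁ (xy , ε , x≢y ∷ [])
    ... | no _     | yes refl = inj₂ (E-sym T xy , ε , (x≢y ∘ sym) ∷ [])
    ... | no s≢x   | no s≢y with first-hit w
    ...   | inj₁ (xy , w′ , ss) = inj₁ (xy , e ◅ w′ , s≢y ∷ ss)
    ...   | inj₂ (yx , w′ , ss) = inj₂ (yx , e ◅ w′ , s≢x ∷ ss)

  -- A second parent `z` would give a walk from `x` through the root to `z` and on to `y`, around
  -- the bridge `x y`.
  parent-unique : Child x y → Child z y → x ≡ z
  parent-unique {x} {y} {z} (xy , p) (zy , q) = decidable-stable em λ x≢z →
    bridge em T acyclic xy
      (reverse (E-sym (T ∖ (x , y))) (avoid₂ T p) ◅◅ avoid₂ T q ◅◅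
       (zy , (x≢z ∘ sym ∘ ,-injectiveˡ) , (λ eq → E-irrefl T (,-injectiveˡ eq) zy)) ◅ ε)

  Child-asym : Child x y → ¬ Child y x
  Child-asym {x} {y} (xy , p) (_ , q) =
    bridge em T acyclic xy (reverse (E-sym (T ∖ (x , y))) (avoid₂ T p) ◅◅ avoid₁ T q)

  root-orphan : ¬ Child x root
  root-orphan (_ , p) = start p refl

  unsnoc : x ↓ y → x ≡ y ⊎ (∃[ z ] (x ↓ z × Child z y))
  unsnoc ε = inj₁ refl
  unsnoc (e ◅ w) with unsnoc w
  ... | inj₁ refl         = inj₂ (-, ε , e)
  ... | inj₂ (z , w′ , f) = inj₂ (z , e ◅ w′ , f)

  snoc : x ↓ y → Child y z → x ↓ z
  snoc w e = w ◅◅ e ◅ ε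

  Cuts : V → V → Set ℓ
  Cuts y z = ¬ WalkIn (E T) (_≢ y) root z

  Cuts-Child : Cuts y a → Child a b → Cuts y b
  Cuts-Child {y} {a} cut ab@(edge , _) q with em {a ≡ y}
  -- A walk reaching `b` while avoiding `y` would make `y` a child of `b` too.
  ... | yes refl = Child-asym ab (E-sym T edge , q)
  ... | no a≢y   = cut (q ++ʷ (E-sym T edge ◅ ε , end q ∷ a≢y ∷ []))

  Cuts-↓ : Cuts y a → a ↓ z → Cuts y z
  Cuts-↓ cut ε       = cut
  Cuts-↓ cut (e ◅ w) = Cuts-↓ (Cuts-Child cut e) w

  -- `y` separates itself from the root, hence also everything below it, but the root reaches `x`
  -- while avoiding `y`.
  Child-acyclic : Child x y → ¬ (y ↓ x)
  Child-acyclic (_ , p) y↓x = Cuts-↓ (λ q → end q refl) y↓x p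

  -- Climbing from `z` leaves no choice, because parents are unique.
  comparable : a ↓ z → b ↓ z → a ↓ b ⊎ b ↓ a
  comparable ε       b↓z = inj₂ b↓z
  comparable (e ◅ w) b↓z with comparable w b↓z
  ... | inj₁ a′↓b = inj₁ (e ◅ a′↓b)
  ... | inj₂ b↓a′ with unsnoc b↓a′
  ...   | inj₁ refl = inj₁ (e ◅ ε)
  ...   | inj₂ (_ , b↓p , pa′) with refl ← parent-unique e pa′ = inj₂ b↓p

  ↓-sibling : Child w c → Child w d → c ↓ d → c ≡ d
  ↓-sibling wc wd c↓d with unsnoc c↓d
  ... | inj₁ eq = eq
  ... | inj₂ (_ , c↓p , pd) with refl ← parent-unique wd pd = ⊥-elim (Child-acyclic wc c↓p)

  siblings-disjoint : Child w c → Child w d → c ↓ z → d ↓ z → c ≡ d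
  siblings-disjoint wc wd c↓z d↓z with comparable c↓z d↓z
  ... | inj₁ c↓d = ↓-sibling wc wd c↓d
  ... | inj₂ d↓c = sym (↓-sibling wd wc d↓c)

  -- The only edge leaving the subtree below `c` joins `c` to its parent, and that edge is deleted.
  stay-edge : Child a c → c ↓ x → E (T ∖ (a , c)) x y → c ↓ y
  stay-edge ac c↓x (xy , _ , ≢ca) with orient xy
  ... | inj₁ child = snoc c↓x child
  ... | inj₂ child with unsnoc c↓x
  ...   | inj₂ (_ , c↓p , px) with refl ← parent-unique child px = c↓p
  ...   | inj₁ refl with refl ← parent-unique ac child = ⊥-elim (≢ca refl)

  stay : Child a c → c ↓ x → Walk (T ∖ (a , c)) x y → c ↓ y
  stay ac c↓x ε       = c↓x
  stay ac c↓x (e ◅ w) = stay ac (stay-edge ac c↓x e) w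

  root-↓-walk : root ↓ x → Walk T x y → root ↓ y
  root-↓-walk r↓x ε = r↓x
  root-↓-walk r↓x (e ◅ w) with orient e
  ... | inj₁ child = root-↓-walk (snoc r↓x child) w
  ... | inj₂ child with unsnoc r↓x
  ...   | inj₁ refl = ⊥-elim (root-orphan child)
  ...   | inj₂ (_ , r↓p , px) with refl ← parent-unique child px = root-↓-walk r↓p w

  first-step : a ≢ z → a ↓ z → ∃[ c ] (Child a c × c ↓ z)
  first-step a≢z ε       = ⊥-elim (a≢z refl)
  first-step _   (e ◅ w) = -, e , w

  ↓-connected : {S : Pred V ℓ} → (∀ {z} → x ↓ z → z ↓ y → S z) → x ↓ y → WalkIn (E T) S x y
  ↓-connected s ε       = ε , s ε ε ∷ []
  ↓-connected s (e ◅ w) =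
    let w′ , ss = ↓-connected (λ p q → s (e ◅ p) q) w in proj₁ e ◅ w′ , s ε (e ◅ w) ∷ ss

  -- The binary tree minor from iterated forks.

  module Forks (N : Pred V ℓ) where

    record Fork (v : V) : Set ℓ where
      field
        fork        : V
        above       : v ↓ fork
        child       : Letter → V
        is-child    : ∀ t → Child fork (child t)
        distinct    : child L ≢ child R
        persistent  : ∀ t → N (child t)

    open Fork

    module _ (forks : ∀ {v} → N v → Fork v) (start : Σ V N) where

      next : Σ V N → Letter → Σ V N
      next (v , n) t = child (forks n) t , persistent (forks n) t

      node : Σ V N → List Letter → Σ V N
      node s []      = s
      node s (t ∷ α) = node (next s t) α

      -- `node` consumes words from the front, which suits the induction for disjointness, whereas
      -- `Bω` extends them at the end.
      node-∷ʳ : ∀ s α t → node s (α ∷ʳ t) ≡ next (node s α) t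
      node-∷ʳ s []      t = refl
      node-∷ʳ s (u ∷ α) t = node-∷ʳ (next s u) α t

      top bottom : Σ V N → V
      top    (v , _) = v
      bottom (_ , n) = fork (forks n)

      -- The branch sets: tree paths from a chosen vertex down to its fork.
      Segment : Σ V N → Pred V ℓ
      Segment s y = top s ↓ y × y ↓ bottom s

      top↓bottom : ∀ s → top s ↓ bottom s
      top↓bottom (_ , n) = above (forks n)

      bottom-child : ∀ s t → Child (bottom s) (top (next s t))
      bottom-child (_ , n) t = is-child (forks n) t

      top↓node : ∀ s α → top s ↓ top (node s α)
      top↓node s []      = ε
      top↓node s (t ∷ α) = top↓bottom s ◅◅ bottom-child s t ◅ top↓node (next s t) α

      next-separates : ∀ s t u {y} → top (next s t) ↓ y → top (next s u) ↓ y → t ≡ u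
      next-separates s L L _ _ = refl
      next-separates s R R _ _ = refl
      next-separates s@(_ , n) L R p q =
        ⊥-elim (distinct (forks n) (siblings-disjoint (bottom-child s L) (bottom-child s R) p q))
      next-separates s@(_ , n) R L p q =
        ⊥-elim (distinct (forks n) (siblings-disjoint (bottom-child s L) (bottom-child s R) q p))

      Segment-disjoint : ∀ s α β {y} → Segment (node s α) y → Segment (node s β) y → α ≡ β
      Segment-disjoint s []      []      _       _       = refl
      -- The other segment lies below a child of `bottom s`, so a common vertex would put `bottom s`
      -- below its own child.
      Segment-disjoint s []      (t ∷ β) (_ , p) (q , _) =
        ⊥-elim (Child-acyclic (bottom-child s t) (top↓node (next s t) β ◅◅ q ◅◅ p))
      Segment-disjoint s (t ∷ α) []      (q , _) (_ , p) =
        ⊥-elim (Child-acyclic (bottom-child s t) (top↓node (next s t) α ◅◅ q ◅◅ p))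
      Segment-disjoint s (t ∷ α) (u ∷ β) p       q
        with refl ← next-separates s t u (top↓node (next s t) α ◅◅ proj₁ p)
                                         (top↓node (next s u) β ◅◅ proj₁ q) =
        cong (t ∷_) (Segment-disjoint (next s t) α β p q)

      Segment-edge : ∀ α t → ∃[ u ] ∃[ v ]
        (Segment (node start α) u × Segment (node start (α ∷ʳ t)) v × E T u v)
      Segment-edge α t rewrite node-∷ʳ start α t =
        let s = node start α in
        bottom s , top (next s t) , (top↓bottom s , ε) , (ε , top↓bottom (next s t)) ,
        proj₁ (bottom-child s t)

      Segment-connected : ∀ s → ConnectedOn T (Segment s)
      Segment-connected s (t↓u , u↓b) (t↓v , v↓b) = simplify em
        (reverseʷ (E-sym T) (↓-connected (λ p q → p , q ◅◅ u↓b) t↓u) ++ʷ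
         ↓-connected (λ p q → p , q ◅◅ v↓b) t↓v)

      minor : Bω IsMinorOf T
      minor = record
        { branch    = λ α → Segment (node start α)
        ; nonempty  = λ α → top (node start α) , ε , top↓bottom (node start α)
        ; connected = λ α → Segment-connected (node start α)
        ; disjoint  = Segment-disjoint start _ _
        ; edges     = edge
        }
        where
        edge : ∀ {α β} → E Bω α β → ∃[ u ] ∃[ v ]
          (Segment (node start α) u × Segment (node start β) v × E T u v)
        edge {α} (inj₁ (t , refl)) = Segment-edge α t
        edge {_} {β} (inj₂ (t , refl)) =
          let u , v , u∈ , v∈ , uv = Segment-edge β t in v , u , v∈ , u∈ , E-sym T uv

  -- The herder's play against a winning strategy.

  module Herding (cat : CatWin T) where

    open CatWin cat

    -- Bounds all that the cat can reach, not just its position, and so holds through every later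
    -- answer.
    Confined : Pred V ℓ → List (V × V) → Set ℓ
    Confined S es = ∀ {y} → Walk (T ∖∖ es) (token es) y → S y

    Doomed : V → Set ℓ
    Doomed c = ∀ es → Deletions T es → ¬ Confined (c ↓_) es

    -- Used contrapositively: whatever lies above a surviving (not doomed) vertex survives.
    Doomed-↓ : x ↓ y → Doomed x → Doomed y
    Doomed-↓ x↓y doomed es del conf = doomed es del λ w → x↓y ◅◅ conf w

    root-survives : ¬ Doomed root
    root-survives doomed = doomed [] [] λ {y} _ → root-↓-walk ε (proj₁ (connected root y))

    move : ∀ {e es} → Deletions T (e ∷ es) →
           CatMove (T ∖∖ (e ∷ es)) (token es) (token (e ∷ es))
    move del = legal _ _ del (uncaught _ _ del)

    -- After a move, the last edge of the cat's path is still there. Hence the herder can always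
    -- delete an edge at the cat and force a move.
    has-edge : ∀ {es} → Deletions T es → ∃ (E (T ∖∖ es) (token es))
    has-edge {es} del = decidable-stable em λ none → free del λ w e → none (w , e)
      where
      free : ∀ {es} → Deletions T es → ¬ Isolated (T ∖∖ es) (token es)
      free [] = start-uncaught
      free {e ∷ es} del with x≢y , w , _ ← move del =
        not-isolated (T ∖∖ (e ∷ es)) (x≢y ∘ sym) (reverse (E-sym (T ∖∖ (e ∷ es))) w)

    After : List (V × V) → V × V → List (V × V) → Set ℓ
    After es e es′ =
      ∀ {y} → Walk (T ∖∖ es′) (token es′) y → Walk (T ∖∖ es ∖ e) (token es) y

    -- If the edge is already gone, the play stays as it is; otherwise the cat's answer is itself a
    -- walk avoiding `e`. `After` covers both cases.
    cut : ∀ {es} e → Deletions T es → ∃[ es′ ] (Deletions T es′ × After es e es′)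
    cut {es} e@(a , c) del with em {E (T ∖∖ es) a c}
    ... | yes ac = e ∷ es , ac ∷ del , proj₁ (proj₂ (move (ac ∷ del))) ◅◅_
    ... | no ¬ac = es , del , Star.map λ f →
      f , (λ { refl → ¬ac f }) , (λ { refl → ¬ac (E-sym (T ∖∖ es) f) })

    forget : ∀ es {e} → Walk (T ∖∖ es ∖ e) x y → Walk (T ∖∖ es) x y
    forget _ = Star.map proj₁

    only : ∀ es {e} → Walk (T ∖∖ es ∖ e) x y → Walk (T ∖ e) x y
    only es = Star.map λ (f , ≢e) → undelete {G = T} es f , ≢e

    -- Excludes exactly the subtrees of surviving children of `a`; it holds vacuously at `a` and
    -- outside the subtree of `a`.
    Beside : V → Pred V ℓ
    Beside a y = ∀ {c} → Child a c → c ↓ y → Doomed c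

    -- The cat is below a child of `a`, which must be doomed; cutting the edge to that child traps
    -- the cat there.
    leave-hub : ∀ {es} → Deletions T es → Confined (λ y → a ↓ y × Beside a y) es →
                token es ≢ a → ⊥
    leave-hub {a} {es} del conf x≢a with first-step (x≢a ∘ sym) (proj₁ (conf ε))
    ... | c , ac , c↓x =
      let es′ , del′ , after = cut (a , c) del in
      proj₂ (conf ε) ac c↓x es′ del′ λ w → stay ac c↓x (only es (after w))

    hub : ∀ {es} → Deletions T es → ¬ Confined (λ y → a ↓ y × Beside a y) es
    hub {a} {es} del conf with em {token es ≡ a}
    ... | no x≢a  = leave-hub del conf x≢a
    -- Any deletion forces the cat off `a`, still within the same confinement.
    ... | yes x≡a =
      let _ , e = has-edge del
          x≢y , w , _ = move (e ∷ del)
      in leave-hub (e ∷ del) (λ w′ → conf (forget es (w ◅◅ w′))) (λ y≡a → x≢y (trans x≡a (sym y≡a)))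

    -- Play below a vertex without surviving forks.

    module _ {v : V}
      (linear : ∀ {w c d} → v ↓ w → Child w c → Child w d → c ≢ d → Doomed c ⊎ Doomed d)
      where

      -- Cutting the edge to the surviving child c keeps the cat, which is
      -- not below c, away from every surviving child of p.
      detach : ∀ {es p c} {S : Pred V ℓ} → v ↓ p → Child p c → ¬ Doomed c →
               Deletions T es → ¬ (c ↓ token es) → Confined S es →
               ∃[ es′ ] (Deletions T es′ × Confined (λ y → S y × Beside p y) es′)
      detach {es} {p} {c} v↓p pc ¬doomed del x∉c conf =
        let es′ , del′ , after = cut (p , c) del in
        es′ , del′ , λ w → conf (forget es (after w)) , beside (after w)
        where
        beside : ∀ {y} → Walk (T ∖∖ es ∖ (p , c)) (token es) y → Beside p y
        beside w {d} pd d↓y with em {c ≡ d}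
        ... | yes refl = ⊥-elim
          (x∉c (stay pc d↓y (reverse (E-sym (T ∖ (p , c))) (only es w))))
        ... | no c≢d with linear v↓p pc pd c≢d
        ...   | inj₁ doomed = ⊥-elim (¬doomed doomed)
        ...   | inj₂ doomed = doomed

      -- Induction down the branch from `a` to `b`. If the cat is below the next branch vertex `c`,
      -- cutting `a c` moves the problem to `c`; if not, the same cut leaves only doomed children of
      -- `a` in reach, as for a hub. At `b` the hypothesis is already that of `hub`.
      branch-cut : ∀ {es} → v ↓ a → a ↓ b → ¬ Doomed b → Deletions T es →
                   ¬ Confined (λ y → a ↓ y × Beside b y) es
      branch-cut v↓a ε ¬doomed del conf = hub del conf
      branch-cut {a} {es = es} v↓a (_◅_ {j = c} ac c↓b) ¬doomed del conf with em {c ↓ token es}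
      ... | yes c↓x =
        let es′ , del′ , after = cut (a , c) del in
        branch-cut (snoc v↓a ac) c↓b ¬doomed del′ λ w →
          stay ac c↓x (only es (after w)) , proj₂ (conf (forget es (after w)))
      ... | no ¬c↓x =
        let es′ , del′ , conf′ = detach v↓a ac (¬doomed ∘ Doomed-↓ c↓b) del ¬c↓x conf in
        hub del′ λ w → let (a↓y , _) , beside = conf′ w in a↓y , beside

      -- Descend towards `x` until the next child is doomed or `x` is reached. Siblings have
      -- disjoint subtrees, so that child is the only one above `x`.
      lowest-surviving : ¬ Doomed a → a ↓ x → ∃[ p ] (a ↓ p × ¬ Doomed p × Beside p x)
      lowest-surviving ¬doomed ε = -, ε , ¬doomed , λ xc c↓x → ⊥-elim (Child-acyclic xc c↓x)
      lowest-surviving ¬doomed (_◅_ {j = c} ac c↓x) with em {Doomed c}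
      ... | yes doomed = -, ε , ¬doomed , λ ad d↓x →
        subst Doomed (siblings-disjoint ac ad c↓x d↓x) doomed
      ... | no ¬doomed′ =
        let p , c↓p , rest = lowest-surviving ¬doomed′ c↓x in p , ac ◅ c↓p , rest

      linear-doomed : ¬ ¬ Doomed v
      linear-doomed ¬doomed = ¬doomed λ es del conf →
        let p , v↓p , ¬doomed-p , beside = lowest-surviving ¬doomed (conf ε) in
        case-child es del conf p v↓p ¬doomed-p beside
        where
        case-child : ∀ es → Deletions T es → Confined (v ↓_) es → ∀ p → v ↓ p →
                     ¬ Doomed p → Beside p (token es) → ⊥
        case-child es del conf p v↓p ¬doomed-p beside
          with em {∃[ c ] (Child p c × ¬ Doomed c)}
        -- The surviving branch may be infinite below `p`. Cutting it here leaves the finite part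
        -- from `v` to `p`; the cat is not below `c`, as `beside` would doom `c`.
        ... | yes (c , pc , ¬doomed-c) =
          let es′ , del′ , conf′ = detach v↓p pc ¬doomed-c del (¬doomed-c ∘ beside pc) conf in
          branch-cut ε v↓p ¬doomed-p del′ conf′
        -- The branch ends at `p` by itself, so no preliminary cut is made.
        ... | no none = branch-cut ε v↓p ¬doomed-p del λ w →
          conf w , λ {c} pc _ → decidable-stable em λ ¬doomed-c → none (c , pc , ¬doomed-c)

    open Forks (¬_ ∘ Doomed)

    surviving-fork : ∀ {v} → ¬ Doomed v → Fork v
    surviving-fork {v} ¬doomed = decidable-stable em λ none →
      linear-doomed (linear none) ¬doomed
      where
      linear : ¬ Fork v → ∀ {w c d} → v ↓ w → Child w c → Child w d → c ≢ d →
               Doomed c ⊎ Doomed d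
      linear none {w} {c} {d} v↓w wc wd c≢d with em {Doomed c} | em {Doomed d}
      ... | yes doomed | _          = inj₁ doomed
      ... | no _       | yes doomed = inj₂ doomed
      ... | no ¬c      | no ¬d      = ⊥-elim (none (record
        { fork       = w
        ; above      = v↓w
        ; child      = λ { L → c ; R → d }
        ; is-child   = λ { L → wc ; R → wd }
        ; distinct   = c≢d
        ; persistent = λ { L → ¬c ; R → ¬d }
        }))

    catMinor : Bω IsMinorOf T
    catMinor = minor surviving-fork (root , root-survives)

mainTheorem12 : {ℓ : Level} → ExcludedMiddle (suc ℓ) →
    {V : Set ℓ} (T : Graph V) → IsTree T → CatWin T ⇔ (Bω IsMinorOf T)
mainTheorem12 {ℓ} em T tree =
  mk⇔ (λ cat → Rooted.Herding.catMinor em′ T tree cat) (MinorToCat.catWin em′ T)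
  where
  em′ : ExcludedMiddle ℓ
  em′ {P} = map′ lower lift (em {Lift (suc ℓ) P})
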